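{- Let $D$ be a $3$-dicritical digraph on $n$ vertices that is isomorphic to neither $\overleftrightarrow{K_3}$ nor $\vec{W_3}$. Then $D$ has at most $\binom{n}{2}+\frac{2}{3}n$ arcs.
   Context: Digraphs are finite, with no loops and no parallel arcs (digons, i.e. pairs $uv,vu$, are allowed). A $2$-dicolouring of $D$ is a map $V(D)\to\{1,2\}$ such that each colour class induces an acyclic subdigraph (a digon is a directed cycle). $D$ is $3$-dicritical if $D$ has no $2$-dicolouring but every proper subdigraph has one. $\overleftrightarrow{K_3}$ is the digraph on 3 vertices with all 6 arcs. $\vec{W_3}$ consists of a directed triangle $a\to b\to c\to a$ and a vertex $r$ joined by a digon to each of $a,b,c$. -}

module Defs where

open import Data.Bool using (Bool; true; false; not; T)
open import Data.Fin using (Fin; _≟_)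
open import Data.Fin.Patterns using (0F; 1F; 2F; 3F)
open import Data.Fin.Permutation using (Permutation; _⟨$⟩ʳ_)
open import Data.Fin.Subset using (Subset; _∈_; _∉_)
open import Data.List using (List; _∷_; _∷ʳ_; length; allFin; cartesianProduct; filterᵇ)
open import Data.List.Relation.Unary.Linked using (Linked)
open import Data.List.Relation.Unary.Unique.Propositional using (Unique)
open import Data.Nat using (ℕ)
open import Data.Product using (Σ; Σ-syntax; ∃; ∃-syntax; _×_; proj₁; uncurry)
open import Data.Sum using (_⊎_)
open import Function using (_on_)
open import Level using (0ℓ)
open import Relation.Binary using (Rel)
open import Relation.Binary.PropositionalEquality using (_≡_; refl)
open import Relation.Nullary using (¬_; does)

record Digraph (n : ℕ) : Set where
  field
    arc      : Fin n → Fin n → Bool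
    loopless : ∀ v → arc v v ≡ false

  Arc : Rel (Fin n) 0ℓ
  Arc u v = T (arc u v)

  arcCount : ℕ
  arcCount = length (filterᵇ (uncurry arc) (cartesianProduct (allFin n) (allFin n)))

-- The cycle x → x₁ → … → xₖ → x with x , x₁ , … , xₖ distinct is given by x
-- and the list of the xᵢ.  A digon is the case k = 1; the case k = 0 is a loop.
DirectedCycle : {V : Set} → Rel V 0ℓ → Set
DirectedCycle {V} R =
  Σ[ x ∈ V ] Σ[ xs ∈ List V ] Unique (x ∷ xs) × Linked R (x ∷ (xs ∷ʳ x))

Acyclic : {V : Set} → Rel V 0ℓ → Set
Acyclic R = ¬ DirectedCycle R

Induced : {V : Set} → Rel V 0ℓ → (P : V → Set) → Rel (Σ V P) 0ℓ
Induced R P = R on proj₁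

IsTwoDicolouring : {V : Set} → Rel V 0ℓ → (V → Fin 2) → Set
IsTwoDicolouring R c = ∀ i → Acyclic (Induced R (λ v → c v ≡ i))

TwoDicolourable : {V : Set} → Rel V 0ℓ → Set
TwoDicolourable R = ∃[ c ] IsTwoDicolouring R c

record Subdigraph {n : ℕ} (D : Digraph n) : Set where
  field
    verts    : Subset n
    arc      : Fin n → Fin n → Bool
    arc-sub  : ∀ {u v} → T (arc u v) → Digraph.Arc D u v
    arc-ends : ∀ {u v} → T (arc u v) → u ∈ verts × v ∈ verts

  Vertex : Set
  Vertex = ∃ (_∈ verts)

  Arc : Rel Vertex 0ℓ
  Arc = (λ u v → T (arc u v)) on proj₁

  Proper : Set
  Proper = (∃[ v ] v ∉ verts)
         ⊎ (∃[ u ] ∃[ v ] Digraph.Arc D u v × ¬ T (arc u v))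

ThreeDicritical : {n : ℕ} → Digraph n → Set
ThreeDicritical D =
    ¬ TwoDicolourable (Digraph.Arc D)
  × (∀ (H : Subdigraph D) → Subdigraph.Proper H → TwoDicolourable (Subdigraph.Arc H))

infix 4 _≅_

_≅_ : {m n : ℕ} → Digraph m → Digraph n → Set
_≅_ {m} {n} D E =
  Σ[ π ∈ Permutation m n ]
    (∀ u v → Digraph.arc D u v ≡ Digraph.arc E (π ⟨$⟩ʳ u) (π ⟨$⟩ʳ v))

K↔₃ : Digraph 3
K↔₃ = record
  { arc      = λ u v → not (does (u ≟ v))
  ; loopless = λ { 0F → refl ; 1F → refl ; 2F → refl }
  }

-- a , b , c , r are 0F , 1F , 2F , 3F.
W→₃ : Digraph 4
W→₃ = record
  { arc      = arc
  ; loopless = λ { 0F → refl ; 1F → refl ; 2F → refl ; 3F → refl }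
  }
  where
  arc : Fin 4 → Fin 4 → Bool
  arc 0F 1F = true
  arc 1F 2F = true
  arc 2F 0F = true
  arc 3F 0F = true
  arc 3F 1F = true
  arc 3F 2F = true
  arc 0F 3F = true
  arc 1F 3F = true
  arc 2F 3F = true
  arc _  _  = false

{-# OPTIONS --safe #-}
-- Call a pair of vertices a digon, a single pair or a non-edge according as it carries
-- two, one or no arcs; the claim is that digons outnumber non-edges by at most 2n/3.
-- If ab is an arc, a 2-dicolouring of D minus ab gives a and b the same colour, whereas
-- colours alternate along digons.  Hence the ends of a digon path on four vertices are
-- not adjacent and there is no digon 6-cycle; a digon triangle would give K↔₃.  No
-- three pairwise adjacent vertices are joined by digons to a common vertex: a transitive
-- triangle is excluded by deleting its long arc, and a directed one yields W→₃.
-- Now delete vertices: one with at least as many non-edges as digons can be removed.  If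
-- there is none, some component of the digon graph is a star all of whose leaves are
-- adjacent to every remaining vertex; it has at most two leaves and is removed whole.
module Submission where

open import Defs
open import Data.Nat using (ℕ)
open import Data.Nat.Combinatorics using (_C_)
open import Data.Integer using (+_)
open import Data.Rational using (_/_; _+_; _*_; _≤_)
open import Relation.Nullary using (¬_)

open import Data.Bool using (Bool; true; false; T)
open import Data.Empty using (⊥; ⊥-elim)
open import Data.Fin using (Fin; _≟_)
open import Data.Fin.Patterns using (0F; 1F; 2F; 3F)
open import Data.Fin.Permutation using (permutation)
open import Data.Fin.Properties using () renaming (any? to anyFin?)
open import Data.Fin.Subset as Subset using (∁; ⁅_⁆)
open import Data.Fin.Subset.Properties using (_∈?_; ∈⊤; x∈⁅x⁆; x≢y⇒x∉⁅y⁆; x∈p⇒x∉∁p; x∉p⇒x∈∁p)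
import Data.Integer as ℤ
import Data.Integer.Properties as ℤ
open import Data.List using
  (List; []; _∷_; _∷ʳ_; _++_; length; map; filter; filterᵇ; allFin; cartesianProduct)
import Data.List.Membership.DecPropositional as DecMembership
open import Data.List.Membership.Propositional using (_∈_; find; lose)
open import Data.List.Membership.Propositional.Properties using (∈-∃++; ∈-filter⁻; ∈-filter⁺)
open import Data.List.Properties using (map-++; map-∘; length-tabulate)
open import Data.List.Relation.Binary.Permutation.Propositional as ↭ using (_↭_; ↭-sym; ↭-trans; ↭⇒↭ₛ)
import Data.List.Relation.Binary.Permutation.Propositional.Properties as ↭
import Data.List.Relation.Binary.Permutation.Setoid.Properties as ↭ₛ
open import Data.List.Relation.Unary.All as All using (All; []; _∷_)
open import Data.List.Relation.Unary.All.Properties using (¬Any⇒All¬)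
open import Data.List.Relation.Unary.AllPairs using ([]; _∷_)
open import Data.List.Relation.Unary.Any using (here; there; any?)
open import Data.List.Relation.Unary.Linked using (Linked; []; [-]; _∷_)
open import Data.List.Relation.Unary.Unique.Propositional using (Unique)
open import Data.List.Relation.Unary.Unique.Propositional.Properties using (filter⁺; allFin⁺)
open import Data.Nat as ℕ using (suc; _<_; z≤n; s≤s; s≤s⁻¹; _<?_)
open import Data.Nat.Combinatorics using (nC1≡n; nCk+nC[k+1]≡[n+1]C[k+1])
open import Data.Nat.ListAction using (sum)
open import Data.Nat.ListAction.Properties using (sum-++; sum-↭)
open import Data.Nat.Properties using
  ( +-assoc; +-comm; +-suc; *-comm; *-distribˡ-+
  ; +-mono-≤; +-monoʳ-≤; +-monoʳ-<; *-monoʳ-≤; +-cancelʳ-<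
  ; ≤-refl; ≤-trans; ≤∧≢⇒<; n≤1+n; m≤n+m; module ≤-Reasoning )
open import Data.Nat.Tactic.RingSolver using (solve-∀)
open import Data.Product using (∃-syntax; _×_; _,_; proj₁; proj₂; uncurry)
open import Data.Product.Properties using (≡-dec)
import Data.Rational as ℚ
import Data.Rational.Properties as ℚ
open import Data.Rational.Unnormalised as ℚᵘ using (mkℚᵘ; *≤*)
import Data.Rational.Unnormalised.Properties as ℚᵘ
open import Data.Sum using (_⊎_; inj₁; inj₂)
open import Data.Vec.Properties.WithK using ([]=-irrelevant)
open import Function using (_∘_; id)
open import Level using (0ℓ)
open import Relation.Binary using (Rel; DecidableEquality)
open import Relation.Binary.Construct.Closure.Transitive
  using (TransClosure; [_]; _∷_) renaming (_++_ to _++⁺_)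
open import Relation.Binary.PropositionalEquality
open import Relation.Binary.PropositionalEquality.WithK using (≡-irrelevant)
open import Relation.Nullary using (Dec; yes; no; ¬?; _×-dec_; contradiction; T?)
open import Relation.Nullary.Decidable using (⌊_⌋; toWitness; fromWitness; decidable-stable; map′)

-- Closed walks and directed cycles.

bind⁺ : {V W : Set} {R : Rel V 0ℓ} {S : Rel W 0ℓ} (f : V → W) →
  (∀ {u v} → R u v → TransClosure S (f u) (f v)) →
  ∀ {u v} → TransClosure R u v → TransClosure S (f u) (f v)
bind⁺ f g [ r ]   = g r
bind⁺ f g (r ∷ p) = g r ++⁺ bind⁺ f g p

linked⇒closure : {V : Set} {R : Rel V 0ℓ} {x y : V} (xs : List V) →
  Linked R (x ∷ (xs ∷ʳ y)) → TransClosure R x y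
linked⇒closure []       (r ∷ [-]) = [ r ]
linked⇒closure (x ∷ xs) (r ∷ l)   = r ∷ linked⇒closure xs l

module _ {V : Set} (_≟′_ : DecidableEquality V) {R : Rel V 0ℓ} where

  open DecMembership _≟′_ using () renaming (_∈?_ to _∈ˡ?_)

  -- The start `w` is exempt from distinctness, so `x` may be `w` itself; the piece found is then a
  -- directed cycle. The clause about `All` is what keeps `ps` distinct in the recursion.
  prefix : ∀ {w x} {ls : List V} → Linked R (w ∷ ls) → x ∈ ls → Unique ls →
    ∃[ ps ] Linked R (w ∷ (ps ∷ʳ x)) × Unique (x ∷ ps) × (∀ {P : V → Set} → All P ls → All P ps)
  prefix (r ∷ l) (here refl) _ = [] , r ∷ [-] , [] ∷ [] , λ _ → []
  prefix {ls = z ∷ _} (r ∷ l) (there x∈) (z∉ ∷ u) with ps , l′ , x∉ ∷ u′ , sub ← prefix l x∈ u =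
    z ∷ ps , r ∷ l′ , ((All.lookup z∉ x∈ ∘ sym) ∷ x∉) ∷ (sub z∉ ∷ u′) , λ { (p ∷ ps) → p ∷ sub ps }

  close : ∀ {w} {ls : List V} → Linked R (w ∷ ls) → w ∈ ls → Unique ls → DirectedCycle R
  close l w∈ u with ps , l′ , u′ , _ ← prefix l w∈ u = _ , ps , u′ , l′

  -- The path is built from the end of the walk: each new first vertex either lengthens it or
  -- already lies on it, and then closes a cycle.
  simple-path : ∀ {x y} → TransClosure R x y →
    DirectedCycle R ⊎ (∃[ ls ] Linked R (x ∷ ls) × Unique (x ∷ ls) × y ∈ ls)
  push : ∀ {x y w} {ls : List V} → R x w → Linked R (w ∷ ls) → Unique (w ∷ ls) → y ∈ w ∷ ls →
    DirectedCycle R ⊎ (∃[ ls ] Linked R (x ∷ ls) × Unique (x ∷ ls) × y ∈ ls)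
  push {x} {w = w} {ls} r l u y∈ with x ∈ˡ? (w ∷ ls)
  ... | yes x∈ = inj₁ (close (r ∷ l) x∈ u)
  ... | no x∉  = inj₂ (w ∷ ls , r ∷ l , ¬Any⇒All¬ _ x∉ ∷ u , y∈)
  simple-path [ r ]   = push r [-] ([] ∷ []) (here refl)
  simple-path (r ∷ p) with simple-path p
  ... | inj₁ c                 = inj₁ c
  ... | inj₂ (ls , l , u , y∈) = push r l u (there y∈)

  closed⇒cycle : ∀ {x} → TransClosure R x x → DirectedCycle R
  closed⇒cycle p with simple-path p
  ... | inj₁ c                 = c
  ... | inj₂ (_ , l , _ ∷ u , x∈) = close l x∈ u

-- Two-colourings in terms of monochromatic closed walks.

Mono : {V : Set} → Rel V 0ℓ → (V → Fin 2) → Rel V 0ℓ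
Mono R c u v = R u v × c u ≡ c v

-- Being a 2-dicolouring in terms of closed walks, which, unlike cycles, can be rerouted freely.
Proper₂ : {V : Set} → Rel V 0ℓ → (V → Fin 2) → Set
Proper₂ R c = ∀ {x} → ¬ TransClosure (Mono R c) x x

proper⇒dicolouring : {V : Set} {R : Rel V 0ℓ} {c : V → Fin 2} → Proper₂ R c → IsTwoDicolouring R c
proper⇒dicolouring proper i (x , xs , _ , l) =
  proper (bind⁺ proj₁ (λ {u} {v} r → [ r , trans (proj₂ u) (sym (proj₂ v)) ]) (linked⇒closure xs l))

dicolouring⇒proper : {V : Set} (_≟′_ : DecidableEquality V) {R : Rel V 0ℓ} {c : V → Fin 2} →
  IsTwoDicolouring R c → Proper₂ R c
dicolouring⇒proper _≟′_ {R} {c} dic {x} p =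
  -- A monochromatic walk stays inside one colour class, where equality is decidable because proofs
  -- of `c v ≡ i` are irrelevant.
  dic (c x) (closed⇒cycle (≡-dec _≟′_ λ p q → yes (≡-irrelevant p q)) (colour refl refl p))
  where
  colour : ∀ {i u v} (cu : c u ≡ i) (cv : c v ≡ i) → TransClosure (Mono R c) u v →
           TransClosure (Induced R (λ v → c v ≡ i)) (u , cu) (v , cv)
  colour cu cv [ r , _ ]       = [ r ]
  colour cu cv ((r , eq) ∷ p) = r ∷ colour (trans (sym eq) cu) cv p

two-colours : {i j k : Fin 2} → i ≢ j → j ≢ k → i ≡ k
two-colours {0F} {0F} p q = contradiction refl p
two-colours {0F} {1F} {0F} p q = refl
two-colours {0F} {1F} {1F} p q = contradiction refl q
two-colours {1F} {0F} {0F} p q = contradiction refl q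
two-colours {1F} {0F} {1F} p q = refl
two-colours {1F} {1F} p q = contradiction refl p

digon-colours : {V : Set} {R : Rel V 0ℓ} {c : V → Fin 2} → Proper₂ R c →
                ∀ {u v} → R u v → R v u → c u ≢ c v
digon-colours proper uv vu eq = proper ((uv , eq) ∷ [ vu , sym eq ])

-- Forbidden configurations in a 3-dicritical digraph.

arc⇒≢ : ∀ {n} (D : Digraph n) {u v} → Digraph.Arc D u v → u ≢ v
arc⇒≢ D {u} uv refl = subst T (Digraph.loopless D u) uv

module Critical {n} (D : Digraph n) (critical : ThreeDicritical D) where

  open Digraph D

  ¬proper : ∀ {c} → ¬ Proper₂ Arc c
  ¬proper proper = proj₁ critical (_ , proper⇒dicolouring proper)

  -- The colouring is extended to all of `D`, so that deletion arguments can speak of walks in `D`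
  -- itself.
  subdigraph-colouring : (H : Subdigraph D) → Subdigraph.Proper H →
    ∃[ c ] Proper₂ (λ u v → T (Subdigraph.arc H u v)) c
  subdigraph-colouring H H-proper with c , dic ← proj₂ critical H H-proper = c′ , proper
    where
    open Subdigraph H using (verts; arc-ends) renaming (arc to arcᴴ)

    c′ : Fin n → Fin 2
    c′ v with v ∈? verts
    ... | yes v∈ = c (v , v∈)
    -- This default is harmless, as arcs of `H` have both ends in `verts`.
    ... | no  _  = 0F

    c′-∈ : ∀ {v} (v∈ : v Subset.∈ verts) → c′ v ≡ c (v , v∈)
    c′-∈ {v} v∈ with v ∈? verts
    ... | yes v∈′ = cong (λ p → c (v , p)) ([]=-irrelevant v∈′ v∈)
    ... | no v∉   = contradiction v∈ v∉

    lift : ∀ {u v} (u∈ : u Subset.∈ verts) (v∈ : v Subset.∈ verts) →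
      TransClosure (Mono (λ u v → T (arcᴴ u v)) c′) u v →
      TransClosure (Mono (Subdigraph.Arc H) c) (u , u∈) (v , v∈)
    lift u∈ v∈ [ r , eq ]     = [ r , trans (sym (c′-∈ u∈)) (trans eq (c′-∈ v∈)) ]
    lift u∈ v∈ ((r , eq) ∷ p) with _ , w∈ ← arc-ends r =
      (r , trans (sym (c′-∈ u∈)) (trans eq (c′-∈ w∈))) ∷ lift w∈ v∈ p

    start : ∀ {u v} → TransClosure (Mono (λ u v → T (arcᴴ u v)) c′) u v → u Subset.∈ verts
    start [ r , _ ]   = proj₁ (arc-ends r)
    start ((r , _) ∷ _) = proj₁ (arc-ends r)

    proper : Proper₂ (λ u v → T (arcᴴ u v)) c′
    proper p = dicolouring⇒proper (≡-dec _≟_ λ p q → yes ([]=-irrelevant p q)) dic (lift (start p) (start p) p)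

  deleted-arc-colouring : ∀ {a b} → Arc a b →
    ∃[ c ] Proper₂ (λ u v → Arc u v × ¬ (u ≡ a × v ≡ b)) c
  deleted-arc-colouring {a} {b} ab =
    proj₁ colouring , λ p → proj₂ colouring (bind⁺ id (λ (r , eq) → [ fromWitness r , eq ]) p)
    where
    keep? : ∀ u v → Dec (Arc u v × ¬ (u ≡ a × v ≡ b))
    keep? u v = T? (arc u v) ×-dec ¬? ((u ≟ a) ×-dec (v ≟ b))
    H : Subdigraph D
    H = record { verts = Subset.⊤ ; arc = λ u v → ⌊ keep? u v ⌋
               ; arc-sub = proj₁ ∘ toWitness ; arc-ends = λ _ → ∈⊤ , ∈⊤ }
    colouring : ∃[ c ] Proper₂ (λ u v → T (Subdigraph.arc H u v)) c
    colouring = subdigraph-colouring H (inj₂ (a , b , ab , λ t → proj₂ (toWitness t) (refl , refl)))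

  deleted-vertex-colouring : ∀ x → ∃[ c ] Proper₂ (λ u v → Arc u v × u ≢ x × v ≢ x) c
  deleted-vertex-colouring x =
    proj₁ colouring , λ p → proj₂ colouring (bind⁺ id (λ (r , eq) → [ fromWitness r , eq ]) p)
    where
    keep? : ∀ u v → Dec (Arc u v × u ≢ x × v ≢ x)
    keep? u v = T? (arc u v) ×-dec (¬? (u ≟ x) ×-dec ¬? (v ≟ x))
    H : Subdigraph D
    H = record { verts = ∁ ⁅ x ⁆ ; arc = λ u v → ⌊ keep? u v ⌋
               ; arc-sub = proj₁ ∘ toWitness
               ; arc-ends = λ t → let _ , u≢x , v≢x = toWitness t in
                   x∉p⇒x∈∁p (x≢y⇒x∉⁅y⁆ u≢x) , x∉p⇒x∈∁p (x≢y⇒x∉⁅y⁆ v≢x) }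
    colouring : ∃[ c ] Proper₂ (λ u v → T (Subdigraph.arc H u v)) c
    colouring = subdigraph-colouring H (inj₁ (x , x∈p⇒x∉∁p (x∈⁅x⁆ x)))

  -- A vertex outside the copy of `E`, or an arc not coming from `E`, could be deleted without
  -- destroying the copy; criticality would then give a 2-dicolouring of `E`.
  non-dicolourable⇒≅ : ∀ {m} (E : Digraph m) → (∀ {c} → ¬ Proper₂ (Digraph.Arc E) c) →
    (g : Fin m → Fin n) → (∀ {i j} → g i ≡ g j → i ≡ j) →
    (∀ {i j} → Digraph.Arc E i j → Arc (g i) (g j)) → D ≅ E
  non-dicolourable⇒≅ {m} E ¬properᴱ g inj hom = permutation g⁻¹ g (λ i → inj (g-g⁻¹ (g i))) g-g⁻¹ , arcs
    where
    open Digraph E using () renaming (Arc to Arcᴱ; arc to arcᴱ)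

    restrict : ∀ {R : Rel (Fin n) 0ℓ} {c} → (∀ {i j} → Arcᴱ i j → R (g i) (g j)) → ¬ Proper₂ R c
    restrict h proper = ¬properᴱ λ p → proper (bind⁺ g (λ (r , eq) → [ h r , eq ]) p)

    surj : ∀ v → ∃[ i ] g i ≡ v
    surj v = decidable-stable (anyFin? λ i → g i ≟ v) λ v∉ →
      restrict (λ r → hom r , (λ eq → v∉ (_ , eq)) , (λ eq → v∉ (_ , eq)))
               (proj₂ (deleted-vertex-colouring v))

    g⁻¹ : Fin n → Fin m
    g⁻¹ = proj₁ ∘ surj

    g-g⁻¹ : ∀ v → g (g⁻¹ v) ≡ v
    g-g⁻¹ = proj₂ ∘ surj

    reflects : ∀ {i j} → Arc (g i) (g j) → Arcᴱ i j
    reflects {i} {j} r = decidable-stable (T? (arcᴱ i j)) λ ¬ij →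
      restrict (λ {k} {l} kl → hom kl , λ (gk≡gi , gl≡gj) → ¬ij (subst₂ Arcᴱ (inj gk≡gi) (inj gl≡gj) kl))
               (proj₂ (deleted-arc-colouring r))

    arcs : ∀ u v → arc u v ≡ arcᴱ (g⁻¹ u) (g⁻¹ v)
    arcs u v = T-ext (λ r → reflects (subst₂ Arc (sym (g-g⁻¹ u)) (sym (g-g⁻¹ v)) r))
                     (λ r → subst₂ Arc (g-g⁻¹ u) (g-g⁻¹ v) (hom r))
      where
      T-ext : ∀ {x y} → (T x → T y) → (T y → T x) → x ≡ y
      T-ext {false} {false} _ _ = refl
      T-ext {false} {true}  _ g = ⊥-elim (g _)
      T-ext {true}  {false} f _ = ⊥-elim (f _)
      T-ext {true}  {true}  _ _ = refl

  Digon : Rel (Fin n) 0ℓ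
  Digon u v = Arc u v × Arc v u

  digon-≢ : ∀ {u v} → Digon u v → u ≢ v
  digon-≢ = arc⇒≢ D ∘ proj₁

  digon-sym : ∀ {u v} → Digon u v → Digon v u
  digon-sym (uv , vu) = vu , uv

  record ArcDeletion (a b : Fin n) : Set where
    field
      colour   : Fin n → Fin 2
      proper   : Proper₂ (λ u v → Arc u v × ¬ (u ≡ a × v ≡ b)) colour
      same     : colour a ≡ colour b

    -- As `z` is not an end of the deleted arc, both arcs of the digon survive.
    digon : ∀ {u z} → Digon u z → z ≢ a → z ≢ b → colour u ≢ colour z
    digon (uz , zu) z≢a z≢b =
      digon-colours {c = colour} proper (uz , λ (_ , z≡b) → z≢b z≡b) (zu , λ (z≡a , _) → z≢a z≡a)

  -- If a and b had different colours, the colouring would be proper for D itself.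
  delete-arc : ∀ {a b} → Arc a b → ArcDeletion a b
  delete-arc {a} {b} ab with c , proper ← deleted-arc-colouring ab = record
    { colour = c ; proper = proper ; same = decidable-stable (c a ≟ c b) λ ca≢cb →
        ¬proper λ p → proper (bind⁺ id
          (λ { (r , eq) → [ (r , λ { (refl , refl) → ca≢cb eq }) , eq ] }) p) }

  -- Deleting `pq` gives `p` and `q` the same colour, but colours alternate along the three digons
  -- from `p` to `q`.
  no-C₄ : ∀ {p u w q} → Arc p q → Digon p u → Digon u w → Digon w q → w ≢ p → u ≢ q → ⊥
  no-C₄ pq pu uw wq w≢p u≢q = digon (digon-sym wq) w≢p (digon-≢ wq)
    (trans (sym same) (two-colours (digon pu (digon-≢ (digon-sym pu)) u≢q)
      (digon (digon-sym uw) (digon-≢ (digon-sym pu)) u≢q ∘ sym)))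
    where open ArcDeletion (delete-arc pq)

  -- Deleting the arc `vu` gives its ends the same colour, while the other five digons alternate
  -- from `u` round to `v`. Only a walk is needed, so `w = w′` is allowed and digon 4-cycles are
  -- covered too.
  no-C₆ : ∀ {v u w x w′ u′} → Digon v u → Digon u w → Digon w x → Digon x w′ → Digon w′ u′ → Digon u′ v →
          w ≢ v → x ≢ v → x ≢ u → u′ ≢ u → ⊥
  no-C₆ vu uw wx xw′ w′u′ u′v w≢v x≢v x≢u u′≢u =
    digon (digon-sym u′v) u′≢v u′≢u (trans same (trans
      (two-colours (digon uw w≢v (digon-≢ (digon-sym uw))) (digon wx x≢v x≢u))
      (two-colours (digon (digon-sym xw′) x≢v x≢u ∘ sym) (digon w′u′ u′≢v u′≢u))))
    where
    open ArcDeletion (delete-arc (proj₁ vu))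
    u′≢v = digon-≢ u′v

  -- After deleting `xz`, the vertices `x`, `y`, `z` share a colour, so any monochromatic walk
  -- through `xz` can be rerouted through `y`. The colouring is therefore proper for `D` as well.
  no-transitive : ∀ {r x y z} → Digon x r → Digon y r → Digon z r → Arc x y → Arc y z → Arc x z → ⊥
  no-transitive {r} {x} {y} {z} xr yr zr xy yz xz = ¬proper {colour} (proper ∘ bind⁺ id detour)
    where
    open ArcDeletion (delete-arc xz)
    r≢x = digon-≢ (digon-sym xr)
    r≢z = digon-≢ (digon-sym zr)
    x≈y : colour x ≡ colour y
    x≈y = two-colours (digon xr r≢x r≢z) (digon yr r≢x r≢z ∘ sym)
    detour : ∀ {u v} → Mono Arc colour u v →
             TransClosure (Mono (λ u v → Arc u v × ¬ (u ≡ x × v ≡ z)) colour) u v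
    detour {u} {v} (uv , eq) with (u ≟ x) ×-dec (v ≟ z)
    ... | no ¬xz            = [ (uv , ¬xz) , eq ]
    ... | yes (refl , refl) =
      ((xy , arc⇒≢ D yz ∘ proj₂) , x≈y) ∷ [ (yz , arc⇒≢ D xy ∘ sym ∘ proj₁) , trans (sym x≈y) same ]

  no-K₃ : ¬ (D ≅ K↔₃) → ∀ {x y z} → Digon x y → Digon y z → Digon z x → ⊥
  no-K₃ ≇K₃ {x} {y} {z} xy@(xy⁺ , xy⁻) yz@(yz⁺ , yz⁻) zx@(zx⁺ , zx⁻) =
    ≇K₃ (non-dicolourable⇒≅ K↔₃ ¬proper-K₃ g inj hom)
    where
    g : Fin 3 → Fin n
    g 0F = x
    g 1F = y
    g 2F = z
    ¬proper-K₃ : ∀ {c} → ¬ Proper₂ (Digraph.Arc K↔₃) c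
    ¬proper-K₃ {c} proper = digon-colours {c = c} proper {2F} {0F} _ _
      (sym (two-colours (digon-colours {c = c} proper {0F} {1F} _ _) (digon-colours {c = c} proper {1F} {2F} _ _)))
    inj : ∀ {i j} → g i ≡ g j → i ≡ j
    inj {0F} {0F} _  = refl
    inj {0F} {1F} eq = contradiction eq (digon-≢ xy)
    inj {0F} {2F} eq = contradiction (sym eq) (digon-≢ zx)
    inj {1F} {0F} eq = contradiction (sym eq) (digon-≢ xy)
    inj {1F} {1F} _  = refl
    inj {1F} {2F} eq = contradiction eq (digon-≢ yz)
    inj {2F} {0F} eq = contradiction eq (digon-≢ zx)
    inj {2F} {1F} eq = contradiction (sym eq) (digon-≢ yz)
    inj {2F} {2F} _  = refl
    hom : ∀ {i j} → Digraph.Arc K↔₃ i j → Arc (g i) (g j)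
    hom {0F} {1F} _ = xy⁺
    hom {0F} {2F} _ = zx⁻
    hom {1F} {0F} _ = xy⁻
    hom {1F} {2F} _ = yz⁺
    hom {2F} {0F} _ = zx⁺
    hom {2F} {1F} _ = yz⁻
    hom {2F} {2F} ()

  no-W₃ : ¬ (D ≅ W→₃) → ∀ {r x y z} → Digon x r → Digon y r → Digon z r → Arc x y → Arc y z → Arc z x → ⊥
  no-W₃ ≇W₃ {r} {x} {y} {z} xr@(xr⁺ , xr⁻) yr@(yr⁺ , yr⁻) zr@(zr⁺ , zr⁻) xy yz zx =
    ≇W₃ (non-dicolourable⇒≅ W→₃ ¬proper-W₃ g inj hom)
    where
    g : Fin 4 → Fin n
    g 0F = x
    g 1F = y
    g 2F = z
    g 3F = r
    ¬proper-W₃ : ∀ {c} → ¬ Proper₂ (Digraph.Arc W→₃) c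
    -- The rim avoids the colour of the hub, so the directed triangle is monochromatic.
    ¬proper-W₃ {c} proper = proper {0F} ((_ , 0≈1) ∷ (_ , trans (sym 0≈1) 0≈2) ∷ [ _ , sym 0≈2 ])
      where
      spoke₀ = digon-colours {c = c} proper {0F} {3F} _ _
      spoke₁ = digon-colours {c = c} proper {1F} {3F} _ _
      spoke₂ = digon-colours {c = c} proper {2F} {3F} _ _
      0≈1 = two-colours spoke₀ (spoke₁ ∘ sym)
      0≈2 = two-colours spoke₀ (spoke₂ ∘ sym)
    inj : ∀ {i j} → g i ≡ g j → i ≡ j
    inj {0F} {0F} _  = refl
    inj {0F} {1F} eq = contradiction eq (arc⇒≢ D xy)
    inj {0F} {2F} eq = contradiction (sym eq) (arc⇒≢ D zx)
    inj {0F} {3F} eq = contradiction eq (digon-≢ xr)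
    inj {1F} {0F} eq = contradiction (sym eq) (arc⇒≢ D xy)
    inj {1F} {1F} _  = refl
    inj {1F} {2F} eq = contradiction eq (arc⇒≢ D yz)
    inj {1F} {3F} eq = contradiction eq (digon-≢ yr)
    inj {2F} {0F} eq = contradiction eq (arc⇒≢ D zx)
    inj {2F} {1F} eq = contradiction (sym eq) (arc⇒≢ D yz)
    inj {2F} {2F} _  = refl
    inj {2F} {3F} eq = contradiction eq (digon-≢ zr)
    inj {3F} {0F} eq = contradiction (sym eq) (digon-≢ xr)
    inj {3F} {1F} eq = contradiction (sym eq) (digon-≢ yr)
    inj {3F} {2F} eq = contradiction (sym eq) (digon-≢ zr)
    inj {3F} {3F} _  = refl
    hom : ∀ {i j} → Digraph.Arc W→₃ i j → Arc (g i) (g j)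
    hom {0F} {1F} _ = xy
    hom {1F} {2F} _ = yz
    hom {2F} {0F} _ = zx
    hom {3F} {0F} _ = xr⁻
    hom {3F} {1F} _ = yr⁻
    hom {3F} {2F} _ = zr⁻
    hom {0F} {3F} _ = xr⁺
    hom {1F} {3F} _ = yr⁺
    hom {2F} {3F} _ = zr⁺

-- Counting on lists.

suc-C-2 : ∀ n → suc n C 2 ≡ n ℕ.+ n C 2
suc-C-2 n = trans (sym (nCk+nC[k+1]≡[n+1]C[k+1] n 1)) (cong (ℕ._+ n C 2) (nC1≡n n))

module _ {A : Set} where

  Unique-resp-↭ : {xs ys : List A} → xs ↭ ys → Unique xs → Unique ys
  Unique-resp-↭ p = ↭ₛ.Unique-resp-↭ (setoid A) (↭⇒↭ₛ p)

  ∈⇒↭∷ : {x : A} {xs : List A} → x ∈ xs → ∃[ ys ] xs ↭ x ∷ ys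
  ∈⇒↭∷ x∈xs with ps , qs , refl ← ∈-∃++ x∈xs = _ , ↭.shift _ ps qs

  ∈-∷⁻ : {x y : A} {xs : List A} → x ∈ y ∷ xs → x ≢ y → x ∈ xs
  ∈-∷⁻ (here x≡y)   x≢y = contradiction x≡y x≢y
  ∈-∷⁻ (there x∈xs) _   = x∈xs

  sum-map-≤-length : (f : A → ℕ) (xs : List A) → (∀ {x} → x ∈ xs → f x ℕ.≤ 1) →
                     sum (map f xs) ℕ.≤ length xs
  sum-map-≤-length f []       _   = z≤n
  sum-map-≤-length f (x ∷ xs) f≤1 =
    +-mono-≤ (f≤1 (here refl)) (sum-map-≤-length f xs (f≤1 ∘ there))

  -- Pigeonhole for a relation in place of a function, so that partners need only exist. Each step
  -- removes the partner of the head from `zs`.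
  injective⇒length≤ : {R : A → A → Set} (us {zs} : List A) → Unique us →
    (∀ {u} → u ∈ us → ∃[ z ] z ∈ zs × R u z) →
    (∀ {u u′ z} → u ∈ us → u′ ∈ us → R u z → R u′ z → u ≡ u′) →
    length us ℕ.≤ length zs
  injective⇒length≤ []       _           _   _   = z≤n
  injective⇒length≤ {R} (u ∷ us) (u∉us ∷ uniq) img inj
    with z , z∈zs , Ruz ← img (here refl)
    with zs′ , zs↭ ← ∈⇒↭∷ z∈zs =
    subst (suc (length us) ℕ.≤_) (sym (↭.↭-length zs↭))
      (s≤s (injective⇒length≤ us uniq img′ λ p q → inj (there p) (there q)))
    where
    img′ : ∀ {v} → v ∈ us → ∃[ y ] y ∈ zs′ × R v y
    img′ v∈us with y , y∈zs , Rvy ← img (there v∈us) =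
      y , ∈-∷⁻ (↭.∈-resp-↭ zs↭ y∈zs)
            -- The partner of `v` is not the removed `z`, since a shared partner would force
            -- `u = v`.
            (λ { refl → All.lookup u∉us v∈us (inj (here refl) (there v∈us) Ruz Rvy) })
        , Rvy

-- Degrees and weights for pair multiplicities at most two.

-- a u v is the number of arcs between u and v.
module Multiplicity {V : Set} (_≟_ : DecidableEquality V) (a : V → V → ℕ)
  (a-sym : ∀ u v → a u v ≡ a v u) (a-irr : ∀ v → a v v ≡ 0) (a≤2 : ∀ u v → a u v ℕ.≤ 2) where

  Digon : V → V → Set
  Digon u v = a u v ≡ 2

  digon? : ∀ u v → Dec (Digon u v)
  digon? u v = a u v ℕ.≟ 2

  digon-sym : ∀ {u v} → Digon u v → Digon v u
  digon-sym {u} {v} = trans (a-sym v u)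

  digon-≢ : ∀ {u v} → Digon u v → u ≢ v
  digon-≢ {u} d refl with () ← trans (sym d) (a-irr u)

  non-digon : ∀ {u v} → ¬ Digon u v → a u v ℕ.≤ 1
  non-digon ¬d = s≤s⁻¹ (≤∧≢⇒< (a≤2 _ _) ¬d)

  deg : V → List V → ℕ
  deg v xs = sum (map (a v) xs)

  -- Each vertex is counted only against those after it, so every unordered pair contributes once.
  weight : List V → ℕ
  weight []       = 0
  weight (x ∷ xs) = deg x xs ℕ.+ weight xs

  deg-↭ : ∀ v {xs ys} → xs ↭ ys → deg v xs ≡ deg v ys
  deg-↭ v p = sum-↭ (↭.map⁺ (a v) p)

  weight-↭ : ∀ {xs ys} → xs ↭ ys → weight xs ≡ weight ys
  weight-↭ ↭.refl       = refl
  weight-↭ (↭.prep x p) = cong₂ ℕ._+_ (deg-↭ x p) (weight-↭ p)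
  weight-↭ (↭.swap {xs} {ys} x y p)
    rewrite deg-↭ x p | deg-↭ y p | weight-↭ p | a-sym x y =
    lemma (a y x) (deg x ys) (deg y ys) (weight ys)
    where
    lemma : ∀ k l m n → (k ℕ.+ l) ℕ.+ (m ℕ.+ n) ≡ (k ℕ.+ m) ℕ.+ (l ℕ.+ n)
    lemma = solve-∀
  weight-↭ (↭.trans p q) = trans (weight-↭ p) (weight-↭ q)

  -- This is the claimed inequality for the vertices in `xs`, multiplied by 3.
  Bounded : List V → Set
  Bounded xs = 3 ℕ.* weight xs ℕ.≤ 3 ℕ.* (length xs C 2) ℕ.+ 2 ℕ.* length xs

  Bounded-resp-↭ : ∀ {xs ys} → xs ↭ ys → Bounded ys → Bounded xs
  Bounded-resp-↭ p b rewrite weight-↭ p | ↭.↭-length p = b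

  private
    -- The allowance `2 * k` stays that of the old vertices; what the new ones bring is left to pay
    -- for excess digons.
    add : ∀ {s t W B} {k} → s ℕ.≤ t → 3 ℕ.* W ℕ.≤ 3 ℕ.* B ℕ.+ 2 ℕ.* k →
          3 ℕ.* (s ℕ.+ W) ℕ.≤ 3 ℕ.* (t ℕ.+ B) ℕ.+ 2 ℕ.* k
    add {s} {t} {W} {B} {k} s≤t b = begin
      3 ℕ.* (s ℕ.+ W)                    ≡⟨ *-distribˡ-+ 3 s W ⟩
      3 ℕ.* s ℕ.+ 3 ℕ.* W                ≤⟨ +-mono-≤ (*-monoʳ-≤ 3 s≤t) b ⟩
      3 ℕ.* t ℕ.+ (3 ℕ.* B ℕ.+ 2 ℕ.* k) ≡⟨ lemma t B k ⟩
      3 ℕ.* (t ℕ.+ B) ℕ.+ 2 ℕ.* k        ∎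
      where
      open ≤-Reasoning
      lemma : ∀ t B k → 3 ℕ.* t ℕ.+ (3 ℕ.* B ℕ.+ 2 ℕ.* k) ≡ 3 ℕ.* (t ℕ.+ B) ℕ.+ 2 ℕ.* k
      lemma = solve-∀

  Bounded-∷ : ∀ {v ys} → deg v ys ℕ.≤ length ys → Bounded ys → Bounded (v ∷ ys)
  Bounded-∷ {v} {ys} d b rewrite suc-C-2 (length ys) =
    ≤-trans (add {B = length ys C 2} {k = length ys} d b) (+-monoʳ-≤ _ (*-monoʳ-≤ 2 (n≤1+n (length ys))))

  Bounded-edge : ∀ {c l ys} → deg c ys ℕ.≤ length ys → deg l ys ℕ.≤ length ys →
                 Bounded ys → Bounded (c ∷ l ∷ ys)
  Bounded-edge {c} {l} {ys} dc dl b
    rewrite suc-C-2 (suc (length ys)) | suc-C-2 (length ys) = begin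
    3 ℕ.* ((a c l ℕ.+ deg c ys) ℕ.+ (deg l ys ℕ.+ weight ys))
      ≡⟨ cong (3 ℕ.*_) (sym (+-assoc (a c l ℕ.+ deg c ys) (deg l ys) (weight ys))) ⟩
    3 ℕ.* ((a c l ℕ.+ deg c ys) ℕ.+ deg l ys ℕ.+ weight ys)
      ≤⟨ add {B = length ys C 2} {k = length ys} (+-mono-≤ (+-mono-≤ (a≤2 c l) dc) dl) b ⟩
    3 ℕ.* ((2 ℕ.+ length ys) ℕ.+ length ys ℕ.+ length ys C 2) ℕ.+ 2 ℕ.* length ys
      -- The digon `cl` costs 3 after scaling and two vertices bring 4, which leaves a slack of one.
      ≤⟨ n≤1+n _ ⟩
    suc (3 ℕ.* ((2 ℕ.+ length ys) ℕ.+ length ys ℕ.+ length ys C 2) ℕ.+ 2 ℕ.* length ys)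
      ≡⟨ lemma (length ys) (length ys C 2) ⟩
    3 ℕ.* (suc (length ys) ℕ.+ (length ys ℕ.+ length ys C 2)) ℕ.+ 2 ℕ.* suc (suc (length ys)) ∎
    where
    open ≤-Reasoning
    lemma : ∀ k B → suc (3 ℕ.* ((2 ℕ.+ k) ℕ.+ k ℕ.+ B) ℕ.+ 2 ℕ.* k)
                    ≡ 3 ℕ.* (suc k ℕ.+ (k ℕ.+ B)) ℕ.+ 2 ℕ.* suc (suc k)
    lemma = solve-∀

  -- The tight case: two excess digons cost 6 after scaling, exactly what three vertices bring.
  Bounded-path : ∀ {c l m ys} → a l m ℕ.≤ 1 →
                 deg c ys ℕ.≤ length ys → deg l ys ℕ.≤ length ys → deg m ys ℕ.≤ length ys →
                 Bounded ys → Bounded (c ∷ l ∷ m ∷ ys)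
  Bounded-path {c} {l} {m} {ys} alm dc dl dm b
    rewrite suc-C-2 (suc (suc (length ys))) | suc-C-2 (suc (length ys)) | suc-C-2 (length ys) = begin
    3 ℕ.* ((a c l ℕ.+ (a c m ℕ.+ deg c ys)) ℕ.+ ((a l m ℕ.+ deg l ys) ℕ.+ (deg m ys ℕ.+ weight ys)))
      ≡⟨ cong (3 ℕ.*_) (assoc (a c l ℕ.+ (a c m ℕ.+ deg c ys)) (a l m ℕ.+ deg l ys) (deg m ys) (weight ys)) ⟩
    3 ℕ.* ((a c l ℕ.+ (a c m ℕ.+ deg c ys)) ℕ.+ (a l m ℕ.+ deg l ys) ℕ.+ deg m ys ℕ.+ weight ys)
      ≤⟨ add {B = length ys C 2} {k = length ys}
           (+-mono-≤ (+-mono-≤ (+-mono-≤ (a≤2 c l) (+-mono-≤ (a≤2 c m) dc)) (+-mono-≤ alm dl)) dm) b ⟩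
    3 ℕ.* ((2 ℕ.+ (2 ℕ.+ length ys)) ℕ.+ (1 ℕ.+ length ys) ℕ.+ length ys ℕ.+ length ys C 2) ℕ.+ 2 ℕ.* length ys
      ≡⟨ lemma (length ys) (length ys C 2) ⟩
    3 ℕ.* (suc (suc (length ys)) ℕ.+ (suc (length ys) ℕ.+ (length ys ℕ.+ length ys C 2)))
      ℕ.+ 2 ℕ.* suc (suc (suc (length ys))) ∎
    where
    open ≤-Reasoning
    assoc : ∀ p q r s → p ℕ.+ (q ℕ.+ (r ℕ.+ s)) ≡ p ℕ.+ q ℕ.+ r ℕ.+ s
    assoc = solve-∀
    lemma : ∀ k B → 3 ℕ.* ((2 ℕ.+ (2 ℕ.+ k)) ℕ.+ (1 ℕ.+ k) ℕ.+ k ℕ.+ B) ℕ.+ 2 ℕ.* k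
                    ≡ 3 ℕ.* (suc (suc k) ℕ.+ (suc k ℕ.+ (k ℕ.+ B))) ℕ.+ 2 ℕ.* suc (suc (suc k))
    lemma = solve-∀

  -- For v ∈ xs, as a v v = 0, this says that v is in at least as many non-edges as digons.
  Light : List V → V → Set
  Light xs v = deg v xs < length xs

  digons nonneighbours : V → List V → List V
  digons v        = filter (digon? v)
  nonneighbours v = filter (λ y → a v y ℕ.≟ 0)

  -- A multiplicity other than 1 is 0, made up for by a non-neighbour, or 2, matched by a digon.
  deg-count : ∀ v xs → deg v xs ℕ.+ length (nonneighbours v xs) ≡ length xs ℕ.+ length (digons v xs)
  deg-count v []       = refl
  deg-count v (x ∷ xs) with ih ← deg-count v xs | a v x | a≤2 v x
  ... | 0 | _ = trans (+-suc _ _) (cong suc ih)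
  ... | 1 | _ = cong suc ih
  ... | 2 | _ = cong suc (trans (cong suc ih) (sym (+-suc _ _)))
  ... | suc (suc (suc _)) | s≤s (s≤s ())

  -- By `deg-count`, lightness means fewer digons than non-neighbours, `v` included. Pairing `v`
  -- with itself makes the injection give a strict inequality.
  light : ∀ {R : V → V → Set} {v xs} → Unique xs → v ∈ xs →
    (∀ {u} → u ∈ xs → Digon v u → ∃[ x ] x ∈ xs × x ≢ v × a v x ≡ 0 × R u x) →
    (∀ {u u′ x} → u ∈ xs → u′ ∈ xs → Digon v u → Digon v u′ → R u x → R u′ x → u ≡ u′) →
    Light xs v
  light {R} {v} {xs} uniq v∈xs img inj = +-cancelʳ-< (length (nonneighbours v xs)) _ _
    (subst (_< length xs ℕ.+ length (nonneighbours v xs)) (sym (deg-count v xs))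
      (+-monoʳ-< (length xs) (injective⇒length≤ (v ∷ digons v xs) uniq′ img′ inj′)))
    where
    -- v is one of its own non-neighbours, outside the image of R.
    Q : V → V → Set
    Q u x = (u ≡ v × x ≡ v) ⊎ (u ∈ xs × Digon v u × x ≢ v × R u x)

    digons⁻ : ∀ {u} → u ∈ digons v xs → u ∈ xs × Digon v u
    digons⁻ = ∈-filter⁻ (digon? v)

    uniq′ : Unique (v ∷ digons v xs)
    uniq′ = All.tabulate (λ p v≡u → digon-≢ (proj₂ (digons⁻ p)) v≡u) ∷ filter⁺ (digon? v) uniq

    img′ : ∀ {u} → u ∈ v ∷ digons v xs → ∃[ x ] x ∈ nonneighbours v xs × Q u x
    img′ (here refl) = v , ∈-filter⁺ _ v∈xs (a-irr v) , inj₁ (refl , refl)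
    img′ (there p) with u∈xs , d ← digons⁻ p
      with x , x∈xs , x≢v , avx , Rux ← img u∈xs d =
      x , ∈-filter⁺ _ x∈xs avx , inj₂ (u∈xs , d , x≢v , Rux)

    inj′ : ∀ {u u′ x} → u ∈ v ∷ digons v xs → u′ ∈ v ∷ digons v xs → Q u x → Q u′ x → u ≡ u′
    inj′ _ _ (inj₁ (refl , _)) (inj₁ (refl , _)) = refl
    inj′ _ _ (inj₁ (_ , x≡v)) (inj₂ (_ , _ , x≢v , _)) = contradiction x≡v x≢v
    inj′ _ _ (inj₂ (_ , _ , x≢v , _)) (inj₁ (_ , x≡v)) = contradiction x≡v x≢v
    inj′ _ _ (inj₂ (u∈ , d , _ , r)) (inj₂ (u′∈ , d′ , _ , r′)) = inj u∈ u′∈ d d′ r r′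

  -- Removing light vertices and star components.

  module Excess
    (P₄-free : ∀ {v u w x} → Digon v u → Digon u w → Digon w x → w ≢ v → x ≢ u →
               x ≢ v × a v x ≡ 0)
    (C₆-free : ∀ {v u w x u′ w′} →
               Digon v u → Digon u w → Digon w x → w ≢ v → x ≢ u →
               Digon v u′ → Digon u′ w′ → Digon w′ x → w′ ≢ v → x ≢ u′ → u ≡ u′)
    (claw    : ∀ {c l l′ l″} → Digon c l → Digon c l′ → Digon c l″ →
               a l l′ ≡ 0 ⊎ a l l″ ≡ 0 ⊎ a l′ l″ ≡ 0)
    where

    module Heavy {xs} (uniq : Unique xs) (heavy : ∀ {v} → v ∈ xs → ¬ Light xs v) where

      -- The digon `vu` starts a digon path `v u w x` inside `xs`; `P₄-free` separates `x` from `v`.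
      Extends : V → V → Set
      Extends v u = ∃[ w ] w ∈ xs × (Digon u w × w ≢ v) × ∃[ x ] x ∈ xs × Digon w x × x ≢ u

      extends? : ∀ v u → Dec (Extends v u)
      extends? v u = any∈? λ w → (digon? u w ×-dec ¬? (w ≟ v)) ×-dec
                     any∈? λ x → digon? w x ×-dec ¬? (x ≟ u)
        where
        any∈? : {P : V → Set} → (∀ x → Dec (P x)) → Dec (∃[ x ] x ∈ xs × P x)
        any∈? P? = map′ find (λ (_ , x∈xs , p) → lose x∈xs p) (any? P? xs)

      -- If every digon vu extended to a digon path v u w x, then u ↦ x would inject the
      -- digon neighbours of v into its non-neighbours.
      dead-end : ∀ {v} → v ∈ xs → ∃[ u ] u ∈ xs × Digon v u × ¬ Extends v u
      dead-end {v} v∈xs with any? (λ u → digon? v u ×-dec ¬? (extends? v u)) xs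
      ... | yes p = find p
      ... | no ¬p = contradiction (light {R} uniq v∈xs img inj) (heavy v∈xs)
        where
        R : V → V → Set
        R u x = ∃[ w ] Digon u w × Digon w x × w ≢ v × x ≢ u

        img : ∀ {u} → u ∈ xs → Digon v u → ∃[ x ] x ∈ xs × x ≢ v × a v x ≡ 0 × R u x
        img {u} u∈xs d with decidable-stable (extends? v u) (λ ¬e → ¬p (lose u∈xs (d , ¬e)))
        ... | w , _ , (uw , w≢v) , x , x∈xs , wx , x≢u with P₄-free d uw wx w≢v x≢u
        ... | x≢v , avx = x , x∈xs , x≢v , avx , w , uw , wx , w≢v , x≢u

        inj : ∀ {u u′ x} → u ∈ xs → u′ ∈ xs → Digon v u → Digon v u′ → R u x → R u′ x → u ≡ u′
        inj _ _ d d′ (w , uw , wx , w≢v , x≢u) (w′ , uw′ , wx′ , w′≢v , x≢u′) =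
          C₆-free d uw wx w≢v x≢u d′ uw′ wx′ w′≢v x≢u′

      Leaf : V → V → Set
      Leaf c l = ∀ {x} → x ∈ xs → Digon l x → x ≡ c

      Star : V → Set
      Star c = ∀ {w} → w ∈ xs → Digon c w → Leaf c w

      -- A leaf has at most one digon, so one non-neighbour besides itself would make it light.
      leaf-adjacent : ∀ {c l x} → l ∈ xs → Leaf c l → x ∈ xs → x ≢ l → a l x ≢ 0
      leaf-adjacent {l = l} {x} l∈xs leaf x∈xs x≢l alx = heavy l∈xs
        (light {λ _ u → u ≡ x} uniq l∈xs (λ _ _ → x , x∈xs , x≢l , alx , refl)
          (λ p q d e _ _ → trans (leaf p d) (sym (leaf q e))))

      -- The dead end at `l` can only be `c`, so no digon path `l c w x` exists and every other
      -- neighbour `w` of `c` is a leaf.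
      leaf⇒star : ∀ {c l} → l ∈ xs → Digon l c → Leaf c l → Star c
      leaf⇒star {c} {l} l∈xs lc leaf {w} w∈xs cw {x} x∈xs wx with w ≟ l | x ≟ c
      ... | _        | yes x≡c = x≡c
      ... | yes refl | _       = leaf x∈xs wx
      ... | no w≢l   | no x≢c  with u , u∈xs , lu , ¬e ← dead-end l∈xs
        with refl ← leaf u∈xs lu = contradiction (w , w∈xs , (cw , w≢l) , x , x∈xs , wx , x≢c) ¬e

      -- Take a dead end `u` at `v`. Either `u` is a leaf with centre `v`, or it has another digon
      -- neighbour `w`, which is a leaf with centre `u` because `v u w` does not extend.
      star : ∀ {v} → v ∈ xs → ∃[ c ] ∃[ l ] c ∈ xs × l ∈ xs × Digon c l × Star c
      star {v} v∈xs with u , u∈xs , vu , ¬e ← dead-end v∈xs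
        with any? (λ w → digon? u w ×-dec ¬? (w ≟ v)) xs
      ... | no ¬p = v , u , v∈xs , u∈xs , vu , leaf⇒star u∈xs (digon-sym vu)
                    λ {x} x∈xs ux → decidable-stable (x ≟ v) λ x≢v → ¬p (lose x∈xs (ux , x≢v))
      ... | yes p with w , w∈xs , uw , w≢v ← find p =
        u , w , u∈xs , w∈xs , uw , leaf⇒star w∈xs (digon-sym uw)
        λ {x} x∈xs wx → decidable-stable (x ≟ u) λ x≢u → ¬e (w , w∈xs , (uw , w≢v) , x , x∈xs , wx , x≢u)

    non-digons⇒deg≤ : ∀ {v} ys → (∀ {y} → y ∈ ys → ¬ Digon v y) → deg v ys ℕ.≤ length ys
    non-digons⇒deg≤ {v} ys ¬d = sum-map-≤-length (a v) ys (non-digon ∘ ¬d)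

    -- Induction on a bound `k` for the length, because a step removes one, two or three vertices.
    bounded : ∀ k xs → length xs ℕ.≤ k → Unique xs → Bounded xs
    bounded _       []         _    _    = z≤n
    bounded (suc k) xs@(_ ∷ _) xs≤k uniq with any? (λ v → deg v xs <? length xs) xs
    ... | yes p with v , v∈xs , lt ← find p with ys , xs↭ ← ∈⇒↭∷ v∈xs
      with _ ∷ uniq-ys ← Unique-resp-↭ xs↭ uniq =
      Bounded-resp-↭ xs↭ (Bounded-∷ {v} {ys} deg≤ (bounded k ys (s≤s⁻¹ (subst (ℕ._≤ suc k) len xs≤k)) uniq-ys))
      where
      len : length xs ≡ suc (length ys)
      len = ↭.↭-length xs↭
      deg≤ : deg v ys ℕ.≤ length ys
      deg≤ = s≤s⁻¹ (subst₂ _<_ (trans (deg-↭ v xs↭) (cong (ℕ._+ deg v ys) (a-irr v))) len lt)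
    ... | no ¬p
      with c , l , c∈xs , l∈xs , cl , st ← Heavy.star uniq (λ v∈xs lt → ¬p (lose v∈xs lt)) (here refl)
      with ys , xs↭ ← ∈⇒↭∷ c∈xs
      with zs , ys↭ ← ∈⇒↭∷ (∈-∷⁻ (↭.∈-resp-↭ xs↭ l∈xs) (digon-≢ (digon-sym cl)))
      with σ ← ↭-trans xs↭ (↭.prep c ys↭)
      with any? (λ m → digon? c m ×-dec ¬? (m ≟ l)) xs
    -- The star is a single digon `cl`.
    ... | no ¬m
      with c∉ ∷ l∉ ∷ uniq-zs ← Unique-resp-↭ σ uniq =
      Bounded-resp-↭ σ (Bounded-edge {c} {l} {zs}
        (non-digons⇒deg≤ zs λ y∈zs cy → ¬m (lose (∈xs y∈zs) (cy , λ y≡l → All.lookup l∉ y∈zs (sym y≡l))))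
        (non-digons⇒deg≤ zs λ y∈zs ly → All.lookup c∉ (there y∈zs) (sym (st l∈xs cl (∈xs y∈zs) ly)))
        (bounded k zs (≤-trans (n≤1+n _) (s≤s⁻¹ (subst (ℕ._≤ suc k) (↭.↭-length σ) xs≤k))) uniq-zs))
      where
      ∈xs : ∀ {y} → y ∈ zs → y ∈ xs
      ∈xs y∈zs = ↭.∈-resp-↭ (↭-sym σ) (there (there y∈zs))
    ... | yes q with m , m∈xs , cm , m≢l ← find q
      with ws , zs↭ ← ∈⇒↭∷ (∈-∷⁻ (∈-∷⁻ (↭.∈-resp-↭ σ m∈xs) (digon-≢ (digon-sym cm))) m≢l)
      with τ ← ↭-trans σ (↭.prep c (↭.prep l zs↭))
      with any? (λ o → digon? c o ×-dec (¬? (o ≟ l) ×-dec ¬? (o ≟ m))) xs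
    -- The star has exactly the leaves `l` and `m`, which do not form a digon.
    ... | no ¬o
      with c∉ ∷ l∉ ∷ m∉ ∷ uniq-ws ← Unique-resp-↭ τ uniq =
      Bounded-resp-↭ τ (Bounded-path {c} {l} {m} {ws}
        (non-digon λ lm → digon-≢ cm (sym (st l∈xs cl m∈xs lm)))
        (non-digons⇒deg≤ ws λ y∈ws cy → ¬o (lose (∈xs y∈ws)
          (cy , (λ y≡l → All.lookup l∉ (there y∈ws) (sym y≡l)) , λ y≡m → All.lookup m∉ y∈ws (sym y≡m))))
        (leaf-deg≤ l∈xs cl)
        (leaf-deg≤ m∈xs cm)
        (bounded k ws (≤-trans (m≤n+m _ 2) (s≤s⁻¹ (subst (ℕ._≤ suc k) (↭.↭-length τ) xs≤k))) uniq-ws))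
      where
      ∈xs : ∀ {y} → y ∈ ws → y ∈ xs
      ∈xs y∈ws = ↭.∈-resp-↭ (↭-sym τ) (there (there (there y∈ws)))
      leaf-deg≤ : ∀ {w} → w ∈ xs → Digon c w → deg w ws ℕ.≤ length ws
      leaf-deg≤ w∈xs cw = non-digons⇒deg≤ ws λ y∈ws wy →
        All.lookup c∉ (there (there y∈ws)) (sym (st w∈xs cw (∈xs y∈ws) wy))
    -- With three leaves, `claw` makes two of them non-adjacent, but here leaves are adjacent to
    -- every other vertex.
    ... | yes r with o , o∈xs , co , o≢l , o≢m ← find r
      with claw cl cm co
    ... | inj₁ lm        = contradiction lm (leaf-adjacent l∈xs (st l∈xs cl) m∈xs m≢l)
      where open Heavy uniq (λ v∈xs lt → ¬p (lose v∈xs lt))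
    ... | inj₂ (inj₁ lo) = contradiction lo (leaf-adjacent l∈xs (st l∈xs cl) o∈xs o≢l)
      where open Heavy uniq (λ v∈xs lt → ¬p (lose v∈xs lt))
    ... | inj₂ (inj₂ mo) = contradiction mo (leaf-adjacent m∈xs (st m∈xs cm) o∈xs o≢m)
      where open Heavy uniq (λ v∈xs lt → ¬p (lose v∈xs lt))

-- The arc count as a sum of multiplicities.

𝟙 : Bool → ℕ
𝟙 true  = 1
𝟙 false = 0

𝟙≤1 : ∀ b → 𝟙 b ℕ.≤ 1
𝟙≤1 true  = s≤s z≤n
𝟙≤1 false = z≤n

length-filterᵇ : {A : Set} (p : A → Bool) (xs : List A) → length (filterᵇ p xs) ≡ sum (map (𝟙 ∘ p) xs)
length-filterᵇ p []       = refl
length-filterᵇ p (x ∷ xs) with p x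
... | true  = cong suc (length-filterᵇ p xs)
... | false = length-filterᵇ p xs

sum-map-+ : {A : Set} (f g : A → ℕ) (xs : List A) →
            sum (map (λ x → f x ℕ.+ g x) xs) ≡ sum (map f xs) ℕ.+ sum (map g xs)
sum-map-+ f g []       = refl
sum-map-+ f g (x ∷ xs) rewrite sum-map-+ f g xs = lemma (f x) (g x) (sum (map f xs)) (sum (map g xs))
  where
  lemma : ∀ p q r s → p ℕ.+ q ℕ.+ (r ℕ.+ s) ≡ p ℕ.+ r ℕ.+ (q ℕ.+ s)
  lemma = solve-∀

sum-map-cartesianProduct : {A B : Set} (f : A × B → ℕ) (xs : List A) (ys : List B) →
  sum (map f (cartesianProduct xs ys)) ≡ sum (map (λ x → sum (map (λ y → f (x , y)) ys)) xs)
sum-map-cartesianProduct f []       ys = refl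
sum-map-cartesianProduct f (x ∷ xs) ys = begin
  sum (map f (map (x ,_) ys ++ cartesianProduct xs ys))
    ≡⟨ cong sum (map-++ f (map (x ,_) ys) _) ⟩
  sum (map f (map (x ,_) ys) ++ map f (cartesianProduct xs ys))
    ≡⟨ sum-++ (map f (map (x ,_) ys)) _ ⟩
  sum (map f (map (x ,_) ys)) ℕ.+ sum (map f (cartesianProduct xs ys))
    ≡⟨ cong₂ ℕ._+_ (cong sum (sym (map-∘ ys))) (sum-map-cartesianProduct f xs ys) ⟩
  sum (map (λ y → f (x , y)) ys) ℕ.+ sum (map (λ x → sum (map (λ y → f (x , y)) ys)) xs) ∎
  where open ≡-Reasoning

module Multiplicities {n} (D : Digraph n) where

  open Digraph D

  mult : Fin n → Fin n → ℕ
  mult u v = 𝟙 (arc u v) ℕ.+ 𝟙 (arc v u)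

  mult-sym : ∀ u v → mult u v ≡ mult v u
  mult-sym u v = +-comm (𝟙 (arc u v)) _

  mult-irr : ∀ v → mult v v ≡ 0
  mult-irr v rewrite loopless v = refl

  mult≤2 : ∀ u v → mult u v ℕ.≤ 2
  mult≤2 u v = +-mono-≤ (𝟙≤1 (arc u v)) (𝟙≤1 (arc v u))

  mult-0 : ∀ u v → mult u v ≡ 0 ⊎ Arc u v ⊎ Arc v u
  mult-0 u v with arc u v | arc v u
  ... | true  | _     = inj₂ (inj₁ _)
  ... | false | true  = inj₂ (inj₂ _)
  ... | false | false = inj₁ refl

  mult-2 : ∀ {u v} → mult u v ≡ 2 → Arc u v × Arc v u
  mult-2 {u} {v} _ with arc u v | arc v u
  mult-2 _  | true  | true  = _
  mult-2 () | true  | false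
  mult-2 () | false | true
  mult-2 () | false | false

  open Multiplicity _≟_ mult mult-sym mult-irr mult≤2 public

  -- The row and the column of the head, without the zero diagonal entry, together make up its
  -- degree into the tail.
  weight-arcs : ∀ xs → length (filterᵇ (uncurry arc) (cartesianProduct xs xs)) ≡ weight xs
  weight-arcs xs = trans (length-filterᵇ _ (cartesianProduct xs xs))
    (trans (sum-map-cartesianProduct _ xs xs) (go xs))
    where
    open ≡-Reasoning
    out : List (Fin n) → Fin n → ℕ
    out ys u = sum (map (λ v → 𝟙 (arc u v)) ys)
    go : ∀ xs → sum (map (out xs) xs) ≡ weight xs
    go []       = refl
    go (x ∷ xs) = begin
      (𝟙 (arc x x) ℕ.+ out xs x) ℕ.+ sum (map (out (x ∷ xs)) xs)
        ≡⟨ cong₂ (λ b → 𝟙 b ℕ.+ out xs x ℕ.+_) (loopless x) (sum-map-+ (λ u → 𝟙 (arc u x)) (out xs) xs) ⟩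
      out xs x ℕ.+ (sum (map (λ u → 𝟙 (arc u x)) xs) ℕ.+ sum (map (out xs) xs))
        ≡⟨ sym (+-assoc (out xs x) _ _) ⟩
      out xs x ℕ.+ sum (map (λ u → 𝟙 (arc u x)) xs) ℕ.+ sum (map (out xs) xs)
        ≡⟨ cong₂ ℕ._+_ (sym (sum-map-+ _ _ xs)) (go xs) ⟩
      weight (x ∷ xs) ∎

-- The integer bound for 3-dicritical digraphs.

3arcs≤ : ∀ {n} (D : Digraph n) → ThreeDicritical D → ¬ (D ≅ K↔₃) → ¬ (D ≅ W→₃) →
         3 ℕ.* Digraph.arcCount D ℕ.≤ 3 ℕ.* (n C 2) ℕ.+ 2 ℕ.* n
3arcs≤ {n} D critical ≇K₃ ≇W₃ =
  subst₂ (λ k l → 3 ℕ.* k ℕ.≤ 3 ℕ.* (l C 2) ℕ.+ 2 ℕ.* l)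
    (sym (weight-arcs (allFin n))) (length-tabulate {n = n} id)
    (Excess.bounded P₄-free C₆-free claw _ (allFin n) ≤-refl (allFin⁺ n))
  where
  open Digraph D
  open Critical D critical using (no-K₃; no-C₄; no-C₆; no-transitive; no-W₃)
  open Multiplicities D renaming (Digon to Digonᵐ)

  P₄-free : ∀ {v u w x} → Digonᵐ v u → Digonᵐ u w → Digonᵐ w x → w ≢ v → x ≢ u →
            x ≢ v × mult v x ≡ 0
  P₄-free {v} {u} {w} {x} vu uw wx w≢v x≢u = x≢v , nonadjacent
    where
    x≢v : x ≢ v
    x≢v refl = no-K₃ ≇K₃ (mult-2 vu) (mult-2 uw) (mult-2 wx)
    nonadjacent : mult v x ≡ 0
    nonadjacent with mult-0 v x
    ... | inj₁ eq        = eq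
    ... | inj₂ (inj₁ vx) = ⊥-elim (no-C₄ vx (mult-2 vu) (mult-2 uw) (mult-2 wx) w≢v (x≢u ∘ sym))
    ... | inj₂ (inj₂ xv) = ⊥-elim (no-C₄ xv (mult-2 (digon-sym wx)) (mult-2 (digon-sym uw))
                             (mult-2 (digon-sym vu)) (x≢u ∘ sym) w≢v)

  C₆-free : ∀ {v u w x u′ w′} →
            Digonᵐ v u → Digonᵐ u w → Digonᵐ w x → w ≢ v → x ≢ u →
            Digonᵐ v u′ → Digonᵐ u′ w′ → Digonᵐ w′ x → w′ ≢ v → x ≢ u′ → u ≡ u′
  C₆-free {u = u} {u′ = u′} vu uw wx w≢v x≢u vu′ u′w′ w′x w′≢v x≢u′ =
    -- If `u` and `u′` differed, one path followed by the reverse of the other would be a closed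
    -- walk of six digons.
    decidable-stable (u ≟ u′) λ u≢u′ → no-C₆
      (mult-2 vu) (mult-2 uw) (mult-2 wx)
      (mult-2 (digon-sym w′x)) (mult-2 (digon-sym u′w′)) (mult-2 (digon-sym vu′))
      w≢v (let x≢v , _ = P₄-free vu uw wx w≢v x≢u in x≢v) x≢u (u≢u′ ∘ sym)

  claw : ∀ {c l l′ l″} → Digonᵐ c l → Digonᵐ c l′ → Digonᵐ c l″ →
         mult l l′ ≡ 0 ⊎ mult l l″ ≡ 0 ⊎ mult l′ l″ ≡ 0
  claw {_} {l} {l′} {l″} cl cl′ cl″ with mult-0 l l′ | mult-0 l l″ | mult-0 l′ l″
  ... | inj₁ eq | _ | _ = inj₁ eq
  ... | inj₂ _ | inj₁ eq | _ = inj₂ (inj₁ eq)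
  ... | inj₂ _ | inj₂ _ | inj₁ eq = inj₂ (inj₂ eq)
  ... | inj₂ p | inj₂ q | inj₂ r = ⊥-elim (tournament p q r)
    where
    d₁ = mult-2 (digon-sym cl)
    d₂ = mult-2 (digon-sym cl′)
    d₃ = mult-2 (digon-sym cl″)
    -- Of the eight orientations of the triangle, two are cyclic and give `W→₃`; the other six are
    -- transitive.
    tournament : Arc l l′ ⊎ Arc l′ l → Arc l l″ ⊎ Arc l″ l → Arc l′ l″ ⊎ Arc l″ l′ → ⊥
    tournament (inj₁ p) (inj₁ q) (inj₁ r) = no-transitive d₁ d₂ d₃ p r q
    tournament (inj₁ p) (inj₁ q) (inj₂ r) = no-transitive d₁ d₃ d₂ q r p
    tournament (inj₁ p) (inj₂ q) (inj₁ r) = no-W₃ ≇W₃ d₁ d₂ d₃ p r q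
    tournament (inj₁ p) (inj₂ q) (inj₂ r) = no-transitive d₃ d₁ d₂ q p r
    tournament (inj₂ p) (inj₁ q) (inj₁ r) = no-transitive d₂ d₁ d₃ p q r
    tournament (inj₂ p) (inj₁ q) (inj₂ r) = no-W₃ ≇W₃ d₁ d₃ d₂ q r p
    tournament (inj₂ p) (inj₂ q) (inj₁ r) = no-transitive d₂ d₃ d₁ r q p
    tournament (inj₂ p) (inj₂ q) (inj₂ r) = no-transitive d₃ d₂ d₁ r p q

-- Passage to rational numbers.

3*≤⇒≤ℚ : ∀ k b n → 3 ℕ.* k ℕ.≤ 3 ℕ.* b ℕ.+ 2 ℕ.* n →
         (+ k) / 1 ≤ (+ b) / 1 + ((+ 2) / 3) * ((+ n) / 1)
3*≤⇒≤ℚ k b n le = ℚ.toℚᵘ-cancel-≤ (begin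
  ℚ.toℚᵘ (+ k / 1)                                ≃⟨ ℚ.toℚᵘ-fromℚᵘ (mkℚᵘ (+ k) 0) ⟩
  -- In unnormalised fractions the inequality is a cross-multiplication. The second argument of
  -- `mkℚᵘ` is the denominator minus one, so `mkℚᵘ (+ 2) 2` is two thirds.
  mkℚᵘ (+ k) 0                                    ≤⟨ *≤* (subst₂ ℤ._≤_ eqˡ eqʳ (ℤ.+≤+ le)) ⟩
  mkℚᵘ (+ b) 0 ℚᵘ.+ mkℚᵘ (+ 2) 2 ℚᵘ.* mkℚᵘ (+ n) 0
    ≃⟨ ℚᵘ.+-cong (ℚ.toℚᵘ-fromℚᵘ (mkℚᵘ (+ b) 0))
         (ℚᵘ.*-cong (ℚ.toℚᵘ-fromℚᵘ (mkℚᵘ (+ 2) 2)) (ℚ.toℚᵘ-fromℚᵘ (mkℚᵘ (+ n) 0))) ⟨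
  ℚ.toℚᵘ (+ b / 1) ℚᵘ.+ ℚ.toℚᵘ (+ 2 / 3) ℚᵘ.* ℚ.toℚᵘ (+ n / 1)
    ≃⟨ ℚᵘ.+-congʳ (ℚ.toℚᵘ (+ b / 1)) (ℚ.toℚᵘ-homo-* (+ 2 / 3) (+ n / 1)) ⟨
  ℚ.toℚᵘ (+ b / 1) ℚᵘ.+ ℚ.toℚᵘ ((+ 2 / 3) * (+ n / 1))
    ≃⟨ ℚ.toℚᵘ-homo-+ (+ b / 1) ((+ 2 / 3) * (+ n / 1)) ⟨
  ℚ.toℚᵘ (+ b / 1 + (+ 2 / 3) * (+ n / 1)) ∎)
  where
  open ℚᵘ.≤-Reasoning
  eqˡ : + (3 ℕ.* k) ≡ + k ℤ.* + 3
  eqˡ = trans (cong +_ (*-comm 3 k)) (ℤ.pos-* k 3)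
  eqʳ : + (3 ℕ.* b ℕ.+ 2 ℕ.* n) ≡ (+ b ℤ.* + 3 ℤ.+ (+ 2 ℤ.* + n) ℤ.* + 1) ℤ.* + 1
  eqʳ = trans (cong₂ ℤ._+_ (trans (cong +_ (*-comm 3 b)) (ℤ.pos-* b 3))
                (trans (ℤ.pos-* 2 n) (sym (ℤ.*-identityʳ _)))) (sym (ℤ.*-identityʳ _))

theorem12 : (n : ℕ) (D : Digraph n) →
    ThreeDicritical D →
    ¬ (D ≅ K↔₃) →
    ¬ (D ≅ W→₃) →
    (+ Digraph.arcCount D) / 1 ≤ (+ (n C 2)) / 1 + ((+ 2) / 3) * ((+ n) / 1)
theorem12 n D critical ≇K₃ ≇W₃ = 3*≤⇒≤ℚ (Digraph.arcCount D) (n C 2) n (3arcs≤ D critical ≇K₃ ≇W₃)
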